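{- Let $O$ be a finite basis of Boolean functions and let $n\ge1$. If $O\preceq\{\wedge,\top,\bot\}$, $O\preceq\{\vee,\top,\bot\}$ or $O\preceq\{\oplus,\top,\bot\}$, then the VC dimension of $\mathsf{PL}_O$ in $n$ variables is at most $n+1$. Otherwise it is $2^{\Omega(n)}$.
   Context: A basis is a finite set $O$ of Boolean functions, each of fixed arity (the truth constants $\top=1$, $\bot=0$ may be members, as $0$-ary functions). A $\mathsf{PL}_O$-formula over $x_1,\dots,x_n$ is a finite tree whose leaves are labeled by variables and whose internal nodes of arity $r$ are labeled by $r$-ary members of $O$ (a truth constant labels a node without children). $[O]$ denotes the clone generated by $O$, i.e. the set of Boolean functions computed by $\mathsf{PL}_O$-formulas, and $O\preceq O'$ means $[O]\subseteq[O']$. $\oplus$ is binary exclusive or. A set $A\subseteq\{0,1\}^n$ is shattered by a class $\mathcal F$ of $n$-ary Boolean functions if every subset of $A$ is of the form $A\cap f^{ -1}(1)$ with $f\in\mathcal F$; the VC dimension of $\mathcal F$ is the largest size of a shattered set. The VC dimension of $\mathsf{PL}_O$ in $n$ variables is that of the class of $n$-ary functions computed by $\mathsf{PL}_O$-formulas over $x_1,\dots,x_n$. The asymptotic bound $2^{\Omega(n)}$ is for fixed $O$ as $n\to\infty$. -}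

module Defs where

open import Data.Bool using (Bool; true; false; _∧_; _∨_; _xor_)
open import Data.Fin using (Fin)
open import Data.List using (List; []; _∷_; length)
open import Data.List.Membership.Propositional using (_∈_)
open import Data.List.Relation.Binary.Subset.Propositional using (_⊆_)
open import Data.List.Relation.Unary.Unique.Propositional using (Unique)
open import Data.Nat using (ℕ; _*_; _^_; _≤_; _<_)
open import Data.Product using (Σ; ∃; ∃-syntax; _×_; _,_)
open import Data.Vec as Vec using (Vec; []; _∷_)
open import Function using (_⇔_)
open import Relation.Binary.PropositionalEquality using (_≡_)

BoolFun : ℕ → Set
BoolFun n = Vec Bool n → Bool

Basis : Set
Basis = List (Σ ℕ BoolFun)

data Formula (O : Basis) (n : ℕ) : Set where
  var  : Fin n → Formula O n
  node : ∀ {r} {g : BoolFun r} → (r , g) ∈ O → (Fin r → Formula O n) → Formula O n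

eval : ∀ {O n} → Formula O n → BoolFun n
eval (var i)            x = Vec.lookup x i
eval (node {g = g} _ φ) x = g (Vec.tabulate λ i → eval (φ i) x)

-- Pointwise, since functions need not be propositionally equal when they
-- agree everywhere.
Computes : ∀ {O n} → Formula O n → BoolFun n → Set
Computes φ f = ∀ x → eval φ x ≡ f x

-- The n-ary part of the clone [ O ]; equivalently, the class of n-ary
-- functions computed by PL_O-formulas over n variables.
[_] : Basis → ∀ {n} → BoolFun n → Set
[ O ] {n} f = ∃[ φ ] Computes {O} {n} φ f

infix 4 _≼_

_≼_ : Basis → Basis → Set
O ≼ O′ = ∀ {n} (f : BoolFun n) → [ O ] f → [ O′ ] f

binary : (Bool → Bool → Bool) → Σ ℕ BoolFun
binary _·_ = 2 , λ { (x ∷ y ∷ []) → x · y }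

constant : Bool → Σ ℕ BoolFun
constant b = 0 , λ _ → b

∧⊤⊥ ∨⊤⊥ ⊕⊤⊥ : Basis
∧⊤⊥ = binary _∧_   ∷ constant true ∷ constant false ∷ []
∨⊤⊥ = binary _∨_   ∷ constant true ∷ constant false ∷ []
⊕⊤⊥ = binary _xor_ ∷ constant true ∷ constant false ∷ []

-- Subsets of {0,1}ⁿ are represented by lists of their elements. Repetitions
-- are harmless here; they are excluded below, where size matters.
Shatters : ∀ {n} → (BoolFun n → Set) → List (Vec Bool n) → Set
Shatters F A =
  ∀ B → B ⊆ A → ∃[ f ] F f × (∀ a → a ∈ B ⇔ (a ∈ A × f a ≡ true))

record IsVCDim {n} (F : BoolFun n → Set) (d : ℕ) : Set where
  field
    attained : ∃[ A ] Unique A × length A ≡ d × Shatters F A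
    maximal  : ∀ A → Unique A → Shatters F A → length A ≤ d

IsVCDimPL : Basis → ℕ → ℕ → Set
IsVCDimPL O n d = IsVCDim {n} [ O ] d

-- For a quantity given by its graph V (V n d: the value at n is d): there is a
-- rational c = p / q > 0 such that 2^(c n) ≤ d for all large n, with the q-th
-- root cleared. Restricting c to the rationals loses nothing, as any positive
-- real constant can be decreased to a rational one.
Is2^Ω⟨n⟩ : (ℕ → ℕ → Set) → Set
Is2^Ω⟨n⟩ V =
  ∃[ p ] ∃[ q ] ∃[ N ] 0 < p × 0 < q ×
    (∀ n → N ≤ n → ∃[ d ] V n d × 2 ^ (p * n) ≤ d ^ q)

{-# OPTIONS --safe #-}
module Submission where

-- Each of the three small clones consists of the functions c · ∏ᵢ xᵢ^aᵢ in a
-- commutative monoid ({0,1}, ·, ε), so it has at most 2ⁿ⁺¹ members of arity n,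
-- while a shattered set of size d needs 2ᵈ of them.
--
-- Otherwise consider the points (1, 0, b, ¬b, 0, …, 0), b ∈ {0,1}ᵐ. On these,
-- constants and negated literals are variables, so the traces of formulas form
-- a class containing the constants and closed under O. Violations of the
-- conditions that characterise the small clones yield closure under ∧ and ∨:
-- those for ∧ and ∨ give ∨ and ∧ respectively unless one of them gives ¬, and
-- ¬ together with a violation of affinity gives ∧. By Shannon expansion every
-- function of b is a trace, so all 2ᵐ points are shattered.
--
-- The VC dimension is found by a bounded search, as the n-ary part of a clone
-- is a finite closure and hence decidable.

open import Data.Nat using (ℕ; _+_; _≤_)
open import Data.Product using (_×_; ∃-syntax)
open import Data.Sum using (_⊎_)
open import Relation.Nullary using (¬_)
open import Defs

open import Algebra.Bundles using (CommutativeSemigroup; CommutativeRing)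
open import Algebra.Structures using (IsCommutativeMonoid)
import Algebra.Properties.CommutativeSemigroup as CommutativeSemigroupProperties
open import Data.Bool using (Bool; true; false; not; _∧_; _∨_; _xor_; if_then_else_)
open import Data.Bool.Properties as Bool using (¬-not)
open import Data.Bool.Solver using (module xor-∧-Solver)
open import Data.Empty using (⊥-elim)
open import Data.Fin using (Fin; zero; suc; _↑ˡ_; _↑ʳ_)
open import Data.Fin.Properties as Fin using (any?; 2↔Bool; *↔×; injective⇒≤)
open import Data.Fin.Subset.Properties using (anySubset?)
open import Data.List as List using (List; []; _∷_; length)
open import Data.List.Membership.Propositional using (_∈_; _∉_; find; lose)
import Data.List.Membership.DecPropositional as DecMembership
open import Data.List.Membership.Propositional.Properties using (∈-lookup; ∈-tabulate⁻)
import Data.List.Properties as List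
open import Data.List.Relation.Binary.Subset.Propositional using (_⊆_)
open import Data.List.Relation.Unary.All as All using ([]; _∷_)
open import Data.List.Relation.Unary.All.Properties using (¬Any⇒All¬)
open import Data.List.Relation.Unary.AllPairs using ([]; _∷_)
open import Data.List.Relation.Unary.Any as Any using (here; there)
open import Data.List.Relation.Unary.Unique.Propositional using (Unique)
import Data.List.Relation.Unary.Unique.Propositional.Properties as Unique
open import Data.Nat using (zero; suc; _*_; _^_; _<_; z≤n; s≤s; _/_; _%_)
open import Data.Nat.DivMod using (m≡m%n+[m/n]*n; m%n<n; m≥n⇒m/n>0)
import Data.Nat.Properties as ℕ
open import Data.Nat.Tactic.RingSolver using (solve-∀)
open import Data.Product using (∃; ∃₂; _,_; proj₁; proj₂)
open import Data.Product.Function.NonDependent.Propositional using (_×-↔_)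
open import Data.Sum using (inj₁; inj₂)
open import Data.Vec as Vec using (Vec; []; _∷_; lookup; tabulate; replicate; zipWith; _++_)
import Data.Vec.Properties as Vec
open import Function using (_∘_; _⇔_; _↔_; mk↔ₛ′; mk⇔; Equivalence; Inverse)
open import Function.Properties.Inverse using (↔-sym; ↔-trans)
open import Level using (0ℓ)
open import Relation.Binary.PropositionalEquality
  using (_≡_; _≢_; refl; sym; trans; cong; cong₂; subst; module ≡-Reasoning)
open import Relation.Nullary using (Dec; yes; no; does; contradiction)
open import Relation.Nullary.Decidable using (¬?; map′; decidable-stable; dec-true; toWitness)
open import Relation.Unary using (Decidable)

-- Finite search

Searchable : Set → Set₁
Searchable A = ∀ {P : A → Set} → Decidable P → Dec (∃ P)

search-Vec : ∀ {A} → Searchable A → ∀ n → Searchable (Vec A n)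
search-Vec search zero    P? = map′ ([] ,_) (λ { ([] , p) → p }) (P? [])
search-Vec search (suc n) P? =
  map′ (λ (x , xs , p) → x ∷ xs , p) (λ { (x ∷ xs , p) → x , xs , p })
       (search λ x → search-Vec search n (P? ∘ (x ∷_)))

all-BoolVec? : ∀ {n} {P : Vec Bool n → Set} → Decidable P → Dec (∀ x → P x)
all-BoolVec? P? =
  map′ (λ none x → decidable-stable (P? x) λ ¬p → none (x , ¬p))
       (λ all (x , ¬p) → ¬p (all x))
       (¬? (anySubset? (¬? ∘ P?)))

does⁻ : ∀ {P : Set} (P? : Dec P) → does P? ≡ true → P
does⁻ (yes p) _ = p

-- Descends from `M`: as long as the bound itself fails `P`, it can be lowered by one.
greatest : ∀ {P : ℕ → Set} → Decidable P → P 0 → ∀ M → (∀ d → P d → d ≤ M) →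
           ∃[ d ] P d × (∀ e → P e → e ≤ d)
greatest P? p₀ zero    bound = 0 , p₀ , bound
greatest P? p₀ (suc M) bound with P? (suc M)
... | yes p = suc M , p , bound
... | no ¬p = greatest P? p₀ M λ d p →
  ℕ.≤-pred (ℕ.≤∧≢⇒< (bound d p) λ { refl → ¬p p })

-- Counting

BoolVec↔Fin : ∀ n → Vec Bool n ↔ Fin (2 ^ n)
BoolVec↔Fin zero    = mk↔ₛ′ (λ _ → zero) (λ _ → []) (λ { zero → refl }) (λ { [] → refl })
BoolVec↔Fin (suc n) =
  ↔-trans (mk↔ₛ′ Vec.uncons (λ (b , x) → b ∷ x) (λ _ → refl) (λ { (_ ∷ _) → refl }))
    (↔-trans (↔-sym 2↔Bool ×-↔ BoolVec↔Fin n) (↔-sym *↔×))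

index : ∀ {n} → Vec Bool n → Fin (2 ^ n)
index = Inverse.to (BoolVec↔Fin _)

vector : ∀ n → Fin (2 ^ n) → Vec Bool n
vector n = Inverse.from (BoolVec↔Fin n)

index-vector : ∀ n (k : Fin (2 ^ n)) → index (vector n k) ≡ k
index-vector n = Inverse.strictlyInverseˡ (BoolVec↔Fin n)

vector-index : ∀ {n} (x : Vec Bool n) → vector n (index x) ≡ x
vector-index = Inverse.strictlyInverseʳ (BoolVec↔Fin _)

cube-injection : ∀ {d K} (f : Vec Bool d → Fin K) → (∀ {x y} → f x ≡ f y → x ≡ y) → 2 ^ d ≤ K
cube-injection {d} f f-injective = injective⇒≤ {f = f ∘ vector d} λ {i} {j} eq →
  trans (sym (index-vector d i)) (trans (cong index (f-injective eq)) (index-vector d j))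

n<2^n : ∀ n → n < 2 ^ n
n<2^n zero    = s≤s z≤n
n<2^n (suc n) = ℕ.+-mono-≤ {1} {2 ^ n} (ℕ.≤-trans (s≤s z≤n) (n<2^n n))
  (ℕ.≤-trans (n<2^n n) (ℕ.m≤m+n (2 ^ n) 0))

2^-cancel-≤ : ∀ {m n} → 2 ^ m ≤ 2 ^ n → m ≤ n
2^-cancel-≤ 2^m≤2^n = ℕ.≮⇒≥ λ n<m → ℕ.<⇒≱ (ℕ.^-monoʳ-< 2 (s≤s (s≤s z≤n)) n<m) 2^m≤2^n

Unique-lookup-injective : ∀ {A : Set} {xs : List A} → Unique xs →
                          ∀ {i j} → List.lookup xs i ≡ List.lookup xs j → i ≡ j
Unique-lookup-injective (_   ∷ _) {zero}  {zero}  _  = refl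
Unique-lookup-injective (x∉ ∷ _) {zero}  {suc j} eq =
  contradiction eq (All.lookup x∉ (∈-lookup j))
Unique-lookup-injective (x∉ ∷ _) {suc i} {zero}  eq =
  contradiction (sym eq) (All.lookup x∉ (∈-lookup i))
Unique-lookup-injective (_   ∷ u) {suc i} {suc j} eq = cong suc (Unique-lookup-injective u eq)

Unique-length-≤ : ∀ {N} {xs : List (Fin N)} → Unique xs → length xs ≤ N
Unique-length-≤ u = injective⇒≤ (Unique-lookup-injective u)

-- Shattering

-- Shattering for a sequence of points, with a subset given by its vector of bits. Equal points
-- cannot receive different bits, so distinctness of the points is implied.
Realises : ∀ {n d} → (BoolFun n → Set) → Vec (Vec Bool n) d → Set
Realises F A = ∀ m → ∃[ f ] F f × Vec.map f A ≡ m

-- Different bit vectors require different functions, so choosing an index of a realiser for each of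
-- them is injective on the cube.
Realises-bound : ∀ {n d K} {F : BoolFun n → Set} {A : Vec (Vec Bool n) d} (e : Fin K → BoolFun n) →
                 (∀ f → F f → ∃[ k ] ∀ x → f x ≡ e k x) → Realises F A → 2 ^ d ≤ K
Realises-bound {A = A} e covers realises = cube-injection code λ {m} {m′} eq →
  trans (sym (realised m)) (trans (cong (λ k → Vec.map (e k) A) eq) (realised m′))
  where
  code : Vec Bool _ → Fin _
  code m = let (f , Ff , _) = realises m in proj₁ (covers f Ff)
  realised : ∀ m → Vec.map (e (code m)) A ≡ m
  realised m = let (f , Ff , eq) = realises m in
    trans (sym (Vec.map-cong (proj₂ (covers f Ff)) A)) eq

module _ {X : Set} where

  select : (A : List X) → Vec Bool (length A) → List X
  select []      []          = []
  select (a ∷ A) (true  ∷ m) = a ∷ select A m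
  select (a ∷ A) (false ∷ m) = select A m

  select-⊆ : ∀ A m → select A m ⊆ A
  select-⊆ []      []          p         = p
  select-⊆ (a ∷ A) (true  ∷ m) (here eq) = here eq
  select-⊆ (a ∷ A) (true  ∷ m) (there p) = there (select-⊆ A m p)
  select-⊆ (a ∷ A) (false ∷ m) p         = there (select-⊆ A m p)

  select-characteristic : ∀ {A} m {f : X → Bool} → Unique A →
    (∀ a → a ∈ A → a ∈ select A m ⇔ f a ≡ true) → Vec.map f (Vec.fromList A) ≡ m
  select-characteristic {[]}    []          []       _ = refl
  select-characteristic {a ∷ A} (true ∷ m)  (a∉A ∷ u) h =
    cong₂ _∷_ (Equivalence.to (h a (here refl)) (here refl))
      (select-characteristic m u λ a′ a′∈A →
        mk⇔ (Equivalence.to (h a′ (there a′∈A)) ∘ there)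
            (λ fa′ → Any.tail (λ { refl → All.lookup a∉A a′∈A refl })
                       (Equivalence.from (h a′ (there a′∈A)) fa′)))
  select-characteristic {a ∷ A} (false ∷ m) (a∉A ∷ u) h =
    cong₂ _∷_
      -- An unselected `a` with `f a` true would occur in the selection from the tail, against
      -- uniqueness.
      (¬-not λ fa → All.lookup a∉A (select-⊆ A m (Equivalence.from (h a (here refl)) fa)) refl)
      (select-characteristic m u λ a′ → h a′ ∘ there)

Shatters⇒Realises : ∀ {n} {F : BoolFun n → Set} {A} → Unique A → Shatters F A →
                    Realises F (Vec.fromList A)
Shatters⇒Realises {A = A} u shatters m with shatters (select A m) (select-⊆ A m)
... | f , Ff , h = f , Ff , select-characteristic m u λ a a∈A →
  mk⇔ (proj₂ ∘ Equivalence.to (h a)) (λ fa → Equivalence.from (h a) (a∈A , fa))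

module _ {n d} {F : BoolFun n → Set} {A : Vec (Vec Bool n) d} (realises : Realises F A) where

  open DecMembership (Vec.≡-dec {n = n} Bool._≟_) using (_∈?_)

  realiser : (m : Fin d → Bool) → ∃[ f ] F f × (∀ i → f (lookup A i) ≡ m i)
  realiser m = let (f , Ff , eq) = realises (tabulate m) in f , Ff , λ i →
    trans (sym (Vec.lookup-map i f A)) (trans (cong (λ v → lookup v i) eq) (Vec.lookup∘tabulate m i))

  -- The bit vector that is true at `i` only separates `i` from every other index.
  Realises-injective : ∀ {i j} → lookup A i ≡ lookup A j → i ≡ j
  Realises-injective {i} {j} eq = let (f , _ , h) = realiser (λ k → does (i Fin.≟ k)) in
    does⁻ (i Fin.≟ j) (trans (sym (h j)) (trans (cong f (sym eq))
      (trans (h i) (dec-true (i Fin.≟ i) refl))))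

  -- The subset `B` is cut out by a realiser of its membership bits.
  Realises⇒Shatters : Shatters F (List.tabulate (lookup A))
  Realises⇒Shatters B B⊆A = let (f , Ff , h) = realiser (λ i → does (lookup A i ∈? B)) in
    f , Ff , λ a → mk⇔
      (λ a∈B → let (i , a≡) = ∈-tabulate⁻ {f = lookup A} (B⊆A a∈B) in
        B⊆A a∈B , trans (cong f a≡) (trans (h i)
          (dec-true (lookup A i ∈? B) (subst (_∈ B) a≡ a∈B))))
      (λ (a∈A , fa) → let (i , a≡) = ∈-tabulate⁻ {f = lookup A} a∈A in
        subst (_∈ B) (sym a≡)
          (does⁻ (lookup A i ∈? B) (trans (sym (h i)) (trans (cong f (sym a≡)) fa))))

-- Decidability of the clone

-- The truth table as a number, which turns pointwise equality of functions into the decidable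
-- equality of a finite type.
code : ∀ {n} → BoolFun n → Fin (2 ^ (2 ^ n))
code {n} f = index (tabulate (f ∘ vector n))

code-cong : ∀ {n} {f g : BoolFun n} → (∀ x → f x ≡ g x) → code f ≡ code g
code-cong {n} f≗g = cong index (Vec.tabulate-cong (f≗g ∘ vector n))

code-injective : ∀ {n} {f g : BoolFun n} → code f ≡ code g → ∀ x → f x ≡ g x
code-injective {n} {f}  {g} eq x = begin
  f x                                        ≡⟨ cong f (vector-index x) ⟨
  f (vector n (index x))                     ≡⟨ Vec.lookup∘tabulate (f ∘ vector n) (index x) ⟨
  lookup (tabulate (f ∘ vector n)) (index x) ≡⟨ cong (λ t → lookup t (index x)) tables ⟩
  lookup (tabulate (g ∘ vector n)) (index x) ≡⟨ Vec.lookup∘tabulate (g ∘ vector n) (index x) ⟩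
  g (vector n (index x))                     ≡⟨ cong g (vector-index x) ⟩
  g x                                        ∎
  where
  open ≡-Reasoning
  tables : tabulate (f ∘ vector n) ≡ tabulate (g ∘ vector n)
  tables = trans (sym (vector-index _)) (trans (cong (vector (2 ^ n)) eq) (vector-index _))

module Enumeration (O : Basis) (n : ℕ) where

  open DecMembership (Fin._≟_ {2 ^ (2 ^ n)}) using (_∈?_)

  codes : List (Formula O n) → List (Fin (2 ^ (2 ^ n)))
  codes = List.map (code ∘ eval)

  ∈-codes⁻ : ∀ (f : BoolFun n) L → code f ∈ codes L → ∃[ k ] ∀ x → f x ≡ eval (List.lookup L k) x
  ∈-codes⁻ f (φ ∷ L) (here eq) = zero , code-injective eq
  ∈-codes⁻ f (φ ∷ L) (there p) = let (k , eq) = ∈-codes⁻ f L p in suc k , eq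

  -- One step of the closure: the arguments are members of `L`, so only finitely many index vectors
  -- `v` have to be tried.
  node-new? : ∀ L → Decidable λ ((r , g) : ∃ BoolFun) → ∃[ v ]
    code (λ x → g (tabulate λ i → eval (List.lookup L (lookup {n = r} v i)) x)) ∉ codes L
  node-new? L (r , g) = search-Vec any? r λ v → ¬? (_ ∈? codes L)

  -- If neither a variable nor a basis function applied to members of `L` gives a new function, then
  -- by induction on formulas every formula is equivalent to a member of `L`.
  extend : ∀ L → (∃[ φ ] code {n} (eval {O} φ) ∉ codes L) ⊎ (∀ φ → code {n} (eval {O} φ) ∈ codes L)
  extend L with any? (λ i → ¬? (code {n} (eval {O} {n} (var i)) ∈? codes L))
  ... | yes (i , new) = inj₁ (var i , new)
  ... | no vars-old with Any.any? (node-new? L) O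
  ...   | yes p = let ((r , g) , g∈O , v , new) = find p in
          inj₁ (node g∈O (List.lookup L ∘ lookup v) , new)
  ...   | no nodes-old = inj₂ old
    where
    old : ∀ φ → code (eval φ) ∈ codes L
    old (var i) = decidable-stable (_ ∈? codes L) λ new → vars-old (i , new)
    old (node {r} {g} g∈O φ) = decidable-stable (_ ∈? codes L) λ new →
      -- Each argument agrees with a member of `L` by induction; substituting these members leaves
      -- the function of the node unchanged.
      nodes-old (lose g∈O (tabulate k , new ∘ subst (_∈ codes L) (code-cong λ x →
        cong g (Vec.tabulate-cong λ i → sym (trans (proj₂ (∈-codes⁻ (eval (φ i)) L (old (φ i))) x)
          (cong (λ j → eval (List.lookup L j) x) (sym (Vec.lookup∘tabulate k i))))))))
      where
      k : Fin r → Fin (length L)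
      k i = proj₁ (∈-codes⁻ (eval (φ i)) L (old (φ i)))

  -- The number `k` is fuel. The codes of `L` are distinct, so there are at most `2 ^ (2 ^ n)` of
  -- them, and the inequality excludes that the fuel runs out.
  saturate : ∀ k L → Unique (codes L) → 2 ^ (2 ^ n) < length L + k →
             ∃[ L′ ] ∀ φ → code {n} (eval {O} φ) ∈ codes L′
  saturate zero L u N<L = ⊥-elim (ℕ.<⇒≱ N<L (begin
    length L + 0     ≡⟨ ℕ.+-identityʳ _ ⟩
    length L         ≡⟨ List.length-map (code ∘ eval) L ⟨
    length (codes L) ≤⟨ Unique-length-≤ u ⟩
    2 ^ (2 ^ n)      ∎))
    where open ℕ.≤-Reasoning
  saturate (suc k) L u N<L with extend L
  ... | inj₁ (φ , new) =
        saturate k (φ ∷ L) (¬Any⇒All¬ _ new ∷ u) (subst (2 ^ (2 ^ n) <_) (ℕ.+-suc (length L) k) N<L)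
  ... | inj₂ all-old = L , all-old

  representatives : List (Formula O n)
  representatives = proj₁ (saturate (suc (2 ^ (2 ^ n))) [] [] (ℕ.n<1+n _))

  represent : ∀ f → [ O ] f → ∃[ k ] ∀ x → f x ≡ eval (List.lookup representatives k) x
  represent f (φ , φ≗f) =
    let (k , eq) = ∈-codes⁻ (eval φ) representatives
                     (proj₂ (saturate (suc (2 ^ (2 ^ n))) [] [] (ℕ.n<1+n _)) φ) in
    k , λ x → trans (sym (φ≗f x)) (eq x)

  Realises? : ∀ {d} (A : Vec (Vec Bool n) d) → Dec (Realises [ O ] A)
  Realises? A = all-BoolVec? λ m →
    map′ (λ (k , eq) → _ , (List.lookup representatives k , λ _ → refl) , eq)
         (λ (f , f∈ , eq) → let (k , f≗) = represent f f∈ in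
           k , trans (sym (Vec.map-cong f≗ A)) eq)
         (any? λ k → Vec.≡-dec Bool._≟_ (Vec.map (eval (List.lookup representatives k)) A) m)

  -- The formula `φ` makes the class nonempty, so that the empty set is shattered and the search for
  -- the greatest dimension has a starting point.
  IsVCDimPL-exists : Formula O n → ∃[ d ] IsVCDimPL O n d
  IsVCDimPL-exists φ
    with d , (A , realises) , maximal ← greatest
           (λ d → search-Vec anySubset? d Realises?)
           ([] , λ { [] → eval φ , (φ , λ _ → refl) , refl })
           (length representatives)
           -- Shattering `d` points takes `2 ^ d` functions, and `d < 2 ^ d`, so the number of
           -- representatives bounds the search.
           (λ d (A , realises) → ℕ.≤-trans (ℕ.<⇒≤ (n<2^n d))
             (Realises-bound (eval ∘ List.lookup representatives) represent realises))
    = d , record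
      { attained = List.tabulate (lookup A) , Unique.tabulate⁺ (Realises-injective realises)
                 , List.length-tabulate (lookup A) , Realises⇒Shatters realises
      ; maximal  = λ A u shatters → maximal _ (Vec.fromList A , Shatters⇒Realises u shatters)
      }

open Enumeration using (IsVCDimPL-exists)

-- Bounds on the VC dimension

IsVCDim-≤ : ∀ {n d K} {F : BoolFun n → Set} (e : Fin K → BoolFun n) →
            (∀ f → F f → ∃[ k ] ∀ x → f x ≡ e k x) → IsVCDim F d → 2 ^ d ≤ K
IsVCDim-≤ e covers dim with A , u , refl , shatters ← IsVCDim.attained dim =
  Realises-bound e covers (Shatters⇒Realises u shatters)

IsVCDim-≥ : ∀ {n d k} {F : BoolFun n → Set} {A : Vec (Vec Bool n) k} →
            Realises F A → IsVCDim F d → k ≤ d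
IsVCDim-≥ {d = d} {A = A} realises dim = subst (_≤ d) (List.length-tabulate (lookup A))
  (IsVCDim.maximal dim _ (Unique.tabulate⁺ (Realises-injective realises)) (Realises⇒Shatters realises))

-- The three small clones

power : Bool → Bool → Bool → Bool
power ε a x = if a then x else ε

power-ε : ∀ ε a → power ε a ε ≡ ε
power-ε ε true  = refl
power-ε ε false = refl

-- Every truth value is `ε` or `not ε`, the zeroth or the first power of `not ε`.
exponent : ∀ ε q → ∃[ a ] power ε a (not ε) ≡ q
exponent true  true  = false , refl
exponent true  false = true  , refl
exponent false true  = true  , refl
exponent false false = false , refl

Bool-elim : ∀ ε {P : Bool → Set} → P ε → P (not ε) → ∀ b → P b
Bool-elim true  p q true  = p
Bool-elim true  p q false = q
Bool-elim false p q true  = q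
Bool-elim false p q false = p

module Linear {_·_ : Bool → Bool → Bool} {ε : Bool} (isCM : IsCommutativeMonoid _≡_ _·_ ε) where

  open IsCommutativeMonoid isCM using (assoc; comm; identityˡ; identityʳ)

  commutativeSemigroup : CommutativeSemigroup 0ℓ 0ℓ
  commutativeSemigroup = record
    { isCommutativeSemigroup = IsCommutativeMonoid.isCommutativeSemigroup isCM }

  open CommutativeSemigroupProperties commutativeSemigroup using (interchange)

  basis : Basis
  basis = binary _·_ ∷ constant true ∷ constant false ∷ []

  linear : ∀ {n} → Bool → Vec Bool n → BoolFun n
  linear c []       []       = c
  linear c (a ∷ as) (x ∷ xs) = power ε a x · linear c as xs

  linear-constant : ∀ {n} c (x : Vec Bool n) → linear c (replicate n false) x ≡ c
  linear-constant c []      = refl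
  linear-constant c (_ ∷ x) = trans (identityˡ _) (linear-constant c x)

  linear-variable : ∀ {n} (i : Fin n) → ∃[ as ] ∀ x → linear ε as x ≡ lookup x i
  linear-variable {suc n} zero    = true ∷ replicate n false , λ { (b ∷ x) →
    trans (cong (b ·_) (linear-constant ε x)) (identityʳ b) }
  linear-variable (suc i) = let (as , eq) = linear-variable i in
    false ∷ as , λ { (b ∷ x) → trans (identityˡ _) (eq x) }

  -- A product of two powers fixes `ε`, so it is determined by its value at `not ε`, which is also
  -- the value of some power. This covers the idempotent operations and ⊕ at once.
  power-· : ∀ a b → ∃[ c ] ∀ x → power ε c x ≡ power ε a x · power ε b x
  power-· a b = let (c , eq) = exponent ε (power ε a (not ε) · power ε b (not ε)) in
    c , Bool-elim ε
      (trans (power-ε ε c) (sym (trans (cong₂ _·_ (power-ε ε a) (power-ε ε b)) (identityˡ ε))))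
      eq

  linear-· : ∀ {n} c d (as bs : Vec Bool n) →
             ∃[ cs ] ∀ x → linear (c · d) cs x ≡ linear c as x · linear d bs x
  linear-· c d []       []       = [] , λ { [] → refl }
  linear-· c d (a ∷ as) (b ∷ bs) = let (e , eq) = power-· a b ; (cs , eqs) = linear-· c d as bs in
    e ∷ cs , λ { (x ∷ xs) → trans (cong₂ _·_ (eq x) (eqs xs)) (interchange _ _ _ _) }

  eval-linear : ∀ {n} (φ : Formula basis n) → ∃₂ λ c as → ∀ x → eval φ x ≡ linear c as x
  eval-linear (var i) = let (as , eq) = linear-variable i in ε , as , λ x → sym (eq x)
  eval-linear (node (here refl) φ) =
    let (c , as , eq₁) = eval-linear (φ zero)
        (d , bs , eq₂) = eval-linear (φ (suc zero))
        (cs , eq)      = linear-· c d as bs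
    in c · d , cs , λ x → trans (cong₂ _·_ (eq₁ x) (eq₂ x)) (sym (eq x))
  eval-linear (node (there (here refl)) φ) = true , replicate _ false , λ x → sym (linear-constant true x)
  eval-linear (node (there (there (here refl))) φ) = false , replicate _ false , λ x → sym (linear-constant false x)

  constant-formula : ∀ {n} b → ∃[ φ ] ∀ x → eval {basis} {n} φ x ≡ b
  constant-formula true  = node (there (here refl)) (λ ()) , λ _ → refl
  constant-formula false = node (there (there (here refl))) (λ ()) , λ _ → refl

  _·ᶠ_ : ∀ {n} → Formula basis n → Formula basis n → Formula basis n
  φ ·ᶠ ψ = node (here refl) λ { zero → φ ; (suc zero) → ψ }

  linear-formula : ∀ {k n} c (as : Vec Bool k) (ψ : Fin k → Formula basis n) →
                   ∃[ φ ] ∀ x → eval {basis} {n} φ x ≡ linear c as (tabulate λ i → eval (ψ i) x)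
  linear-formula c []           ψ = constant-formula c
  linear-formula c (true  ∷ as) ψ = let (φ , eq) = linear-formula c as (ψ ∘ suc) in
    ψ zero ·ᶠ φ , λ x → cong (eval (ψ zero) x ·_) (eq x)
  linear-formula c (false ∷ as) ψ = let (φ , eq) = linear-formula c as (ψ ∘ suc) in
    φ , λ x → trans (eq x) (sym (identityˡ _))

  -- For ⊕ this is affinity; for the idempotent ∧ and ∨ the last factor is
  -- forced by y = x, and the condition says that g preserves the operation.
  Affine : ∀ {n} → BoolFun n → Set
  Affine {n} g = ∀ x y → g (zipWith _·_ x y) ≡ g x · (g y · g (replicate n ε))

  -- Induction on the arity. With first argument `ε` the function is affine again. The point with
  -- first argument `not ε` and rest x is the product of (`not ε`, ε, ..., ε) and (`ε`, x), so
  -- affinity splits off a factor that is independent of x; the exponent `a` is chosen to give this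
  -- factor.
  Affine⇒linear : ∀ {n} (g : BoolFun n) → Affine g → ∃₂ λ c as → ∀ x → g x ≡ linear c as x
  Affine⇒linear {zero}  g _      = g [] , [] , λ { [] → refl }
  Affine⇒linear {suc n} g affine =
    let (c , as , eq) = Affine⇒linear (g ∘ (ε ∷_)) λ x y →
          trans (cong (λ e → g (e ∷ zipWith _·_ x y)) (sym (identityˡ ε))) (affine (ε ∷ x) (ε ∷ y))
        (a , eqₐ) = exponent ε (g (not ε ∷ replicate n ε) · g (ε ∷ replicate n ε))
    in c , a ∷ as , λ { (b ∷ x) → Bool-elim ε {λ b → g (b ∷ x) ≡ power ε a b · linear c as x}
      (begin
        g (ε ∷ x)                  ≡⟨ eq x ⟩
        linear c as x              ≡⟨ identityˡ _ ⟨
        ε · linear c as x          ≡⟨ cong (_· linear c as x) (power-ε ε a) ⟨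
        power ε a ε · linear c as x ∎)
      (begin
        g (not ε ∷ x)
          ≡⟨ cong g (cong₂ _∷_ (identityʳ (not ε)) (trans (Vec.zipWith-replicate₁ _·_ ε x)
               (trans (Vec.map-cong identityˡ x) (Vec.map-id x)))) ⟨
        g (zipWith _·_ (not ε ∷ replicate n ε) (ε ∷ x))
          ≡⟨ affine _ _ ⟩
        g (not ε ∷ replicate n ε) · (g (ε ∷ x) · g (ε ∷ replicate n ε))
          ≡⟨ cong (g (not ε ∷ replicate n ε) ·_) (comm _ _) ⟩
        g (not ε ∷ replicate n ε) · (g (ε ∷ replicate n ε) · g (ε ∷ x))
          ≡⟨ assoc _ _ _ ⟨
        (g (not ε ∷ replicate n ε) · g (ε ∷ replicate n ε)) · g (ε ∷ x)
          ≡⟨ cong₂ _·_ (sym eqₐ) (eq x) ⟩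
        power ε a (not ε) · linear c as x ∎)
      b }
    where open ≡-Reasoning

  module _ (O : Basis) where

    Affine-≼ : (∀ {r g} → (r , g) ∈ O → Affine g) → O ≼ basis
    Affine-≼ affine {n} f (φ , φ≗f) = let (ψ , eq) = translate φ in ψ , λ x → trans (eq x) (φ≗f x)
      where
      translate : (φ : Formula O n) → ∃[ ψ ] ∀ x → eval {basis} ψ x ≡ eval φ x
      translate (var i) = var i , λ _ → refl
      translate (node {g = g} g∈O φ) =
        let (c , as , eq) = Affine⇒linear g (affine g∈O)
            (ψ , eqψ)     = linear-formula c as (λ i → proj₁ (translate (φ i)))
        in ψ , λ x → trans (eqψ x) (trans (sym (eq _))
             (cong g (Vec.tabulate-cong λ i → proj₂ (translate (φ i)) x)))

    -- A finite search over `O` and all pairs of points turns the failure of the inclusion into an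
    -- explicit violation.
    ¬≼⇒¬affine : ¬ O ≼ basis → ∃₂ λ r g → (r , g) ∈ O ×
      (∃₂ λ x y → g (zipWith _·_ x y) ≢ g x · (g y · g (replicate r ε)))
    ¬≼⇒¬affine ¬≼ with Any.any? (λ (r , g) → anySubset? λ x → anySubset? λ y → ¬? (_ Bool.≟ _)) O
    ... | yes p = let ((r , g) , g∈O , x , y , ≢) = find p in r , g , g∈O , x , y , ≢
    ... | no none = ⊥-elim (¬≼ (Affine-≼ λ g∈O x y →
            decidable-stable (_ Bool.≟ _) λ ≢ → none (lose g∈O (x , y , ≢))))

  ≼⇒IsVCDim-≤ : ∀ {O n d} → O ≼ basis → IsVCDimPL O n d → d ≤ n + 1
  ≼⇒IsVCDim-≤ {n = n} {d} O≼ dim = subst (d ≤_) (ℕ.+-comm 1 n) (2^-cancel-≤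
    -- A vector of `suc n` bits encodes a member of the class: its head is the constant, its tail
    -- the exponents.
    (IsVCDim-≤ (λ k → linear (Vec.head (vector (suc n) k)) (Vec.tail (vector (suc n) k)))
      (λ f f∈ → let (φ , φ≗f) = O≼ f f∈ ; (c , as , eq) = eval-linear φ in
        index (c ∷ as) , λ x → trans (sym (φ≗f x)) (trans (eq x)
          (cong (λ v → linear (Vec.head v) (Vec.tail v) x) (sym (vector-index (c ∷ as))))))
      dim))

-- Closed classes containing the constants

table : Bool → Bool → Bool → Bool → Bool → Bool → Bool
table c d e f u v = if u then (if v then f else e) else (if v then d else c)

-- The four values of `k` sum to 0; equivalently, its algebraic normal form has no term uv.
Even : (Bool → Bool → Bool) → Set
Even k = k true true ≡ k false true xor (k true false xor k false false)

Even? : Decidable Even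
Even? k = _ Bool.≟ _

-- The algebraic normal form of a k that is not even is c ⊕ pu ⊕ qv ⊕ uv with
-- c = k 0 0, p = k 1 0 ⊕ c and q = k 0 1 ⊕ c, that is, (u ⊕ q)(v ⊕ p) ⊕ pq ⊕ c.
table-odd : ∀ c d e u v → let p = e xor c ; q = d xor c in
  table c d e (not (d xor (e xor c))) (u xor q) (v xor p) xor ((q ∧ p) xor c) ≡ u ∧ v
-- Five free bits: all 32 cases are decided by computation.
table-odd c d e u v = toWitness {a? = all-BoolVec? {P = P} P?} _ (c ∷ d ∷ e ∷ u ∷ v ∷ [])
  where
  P : Vec Bool 5 → Set
  P (c ∷ d ∷ e ∷ u ∷ v ∷ []) = let p = e xor c ; q = d xor c in
    table c d e (not (d xor (e xor c))) (u xor q) (v xor p) xor ((q ∧ p) xor c) ≡ u ∧ v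
  P? : Decidable P
  P? (c ∷ d ∷ e ∷ u ∷ v ∷ []) = _ Bool.≟ _

module Closure {X : Set} (S : (X → Bool) → Set)
  (S-resp : ∀ {k l} → (∀ z → k z ≡ l z) → S k → S l)
  (S-constant : ∀ b → S (λ _ → b)) where

  Closed₁ : (Bool → Bool) → Set
  Closed₁ u = ∀ {k} → S k → S (u ∘ k)

  Closed₂ : (Bool → Bool → Bool) → Set
  Closed₂ _∙_ = ∀ {k l} → S k → S l → S (λ z → k z ∙ l z)

  Closed₄ : (Bool → Bool → Bool → Bool → Bool) → Set
  Closed₄ F = ∀ {k l m n} → S k → S l → S m → S n → S (λ z → F (k z) (l z) (m z) (n z))

  Closed₁-resp : ∀ u v → (∀ b → u b ≡ v b) → Closed₁ u → Closed₁ v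
  Closed₁-resp u v u≗v closed {k} Sk = S-resp (u≗v ∘ k) (closed Sk)

  Closed₂-resp : ∀ u v → (∀ a b → u a b ≡ v a b) → Closed₂ u → Closed₂ v
  Closed₂-resp u v u≗v closed {k} {l} Sk Sl = S-resp (λ z → u≗v (k z) (l z)) (closed Sk Sl)

  not-closed : ∀ u → u false ≡ true → u true ≡ false → Closed₁ u → Closed₁ not
  not-closed u u₀ u₁ = Closed₁-resp u not λ { false → u₀ ; true → u₁ }

  -- The arguments of `F` belong to the coordinates where (x, y) is 00, 01, 10, 11, so the values
  -- compared are those at x ∧ y, x, y and the all-true point. A drop from true to false along
  -- increasing arguments gives negation. Otherwise `F` is false at x ∧ y and true at the other
  -- three points.
  ∧-violation : ∀ F → Closed₄ F →
    F false false false true ≢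
      F false false true true ∧ (F false true false true ∧ F true true true true) →
    Closed₁ not ⊎ Closed₂ _∨_
  ∧-violation F closed ≢ with F false false false true in e₀ | F false false true true in e₁
                            | F false true false true in e₂ | F true true true true in e₃
  ... | true  | false | _     | _     = inj₁ (not-closed (λ b → F false false b true) e₀ e₁
                                          λ Sk → closed (S-constant _) (S-constant _) Sk (S-constant _))
  ... | true  | true  | false | _     = inj₁ (not-closed (λ b → F false b false true) e₀ e₂
                                          λ Sk → closed (S-constant _) Sk (S-constant _) (S-constant _))
  ... | true  | true  | true  | false = inj₁ (not-closed (λ b → F b b b true) e₀ e₃
                                          λ Sk → closed Sk Sk Sk (S-constant _))
  ... | true  | true  | true  | true  = contradiction refl ≢
  ... | false | false | _     | _     = contradiction refl ≢
  ... | false | true  | false | _     = contradiction refl ≢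
  ... | false | true  | true  | false = contradiction refl ≢
  -- Three values of `F false a b true` now agree with a ∨ b; if the fourth does not, it is a drop.
  ... | false | true  | true  | true  with F false true true true in e₄
  ...   | false = inj₁ (not-closed (λ b → F false b true true) e₁ e₄
                    λ Sk → closed (S-constant _) Sk (S-constant _) (S-constant _))
  ...   | true  = inj₂ (Closed₂-resp (λ a b → F false a b true) _∨_
                    (λ { false false → e₀ ; false true → e₁ ; true false → e₂ ; true true → e₄ })
                    λ Sk Sl → closed (S-constant _) Sk Sl (S-constant _))

  -- The dual case, with the values at x ∨ y, x, y and the all-false point. Without a drop among
  -- them `F` is true at x ∨ y only, and `F false a b true` is a ∧ b unless its value at a = b =
  -- false starts a drop.
  ∨-violation : ∀ F → Closed₄ F →
    F false true true true ≢
      F false false true true ∨ (F false true false true ∨ F false false false false) →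
    Closed₁ not ⊎ Closed₂ _∧_
  ∨-violation F closed ≢ with F false true true true in e₀ | F false false true true in e₁
                            | F false true false true in e₂ | F false false false false in e₃
  ... | false | true  | _     | _     = inj₁ (not-closed (λ b → F false b true true) e₁ e₀
                                          λ Sk → closed (S-constant _) Sk (S-constant _) (S-constant _))
  ... | false | false | true  | _     = inj₁ (not-closed (λ b → F false true b true) e₂ e₀
                                          λ Sk → closed (S-constant _) (S-constant _) Sk (S-constant _))
  ... | false | false | false | true  = inj₁ (not-closed (λ b → F false b b b) e₃ e₀
                                          λ Sk → closed (S-constant _) Sk Sk Sk)
  ... | false | false | false | false = contradiction refl ≢
  ... | true  | true  | _     | _     = contradiction refl ≢
  ... | true  | false | true  | _     = contradiction refl ≢
  ... | true  | false | false | true  = contradiction refl ≢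
  ... | true  | false | false | false with F false false false true in e₄
  ...   | true  = inj₁ (not-closed (λ b → F false b false true) e₄ e₂
                    λ Sk → closed (S-constant _) Sk (S-constant _) (S-constant _))
  ...   | false = inj₂ (Closed₂-resp (λ a b → F false a b true) _∧_
                    (λ { false false → e₄ ; false true → e₁ ; true false → e₂ ; true true → e₀ })
                    λ Sk Sl → closed (S-constant _) Sk Sl (S-constant _))

  module _ (closed-not : Closed₁ not) where

    closed-xor : ∀ c → Closed₁ (_xor c)
    closed-xor false = Closed₁-resp (λ b → b) (_xor false) (λ b → sym (Bool.xor-identityʳ b)) λ Sk → Sk
    closed-xor true  = Closed₁-resp not (_xor true) (λ { false → refl ; true → refl }) closed-not

    odd⇒∧ : ∀ k → Closed₂ k → ¬ Even k → Closed₂ _∧_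
    odd⇒∧ k closed odd = Closed₂-resp (λ u v → k (u xor q) (v xor p) xor s) _∧_
      (λ u v → trans (cong (_xor s) (k≗table (u xor q) (v xor p))) (table-odd c d e u v))
      λ Sk Sl → closed-xor s (closed (closed-xor q Sk) (closed-xor p Sl))
      where
      c d e p q s : Bool
      c = k false false
      d = k false true
      e = k true false
      p = e xor c
      q = d xor c
      s = (q ∧ p) xor c
      k≗table : ∀ u v → k u v ≡ table c d e (not (d xor (e xor c))) u v
      k≗table false false = refl
      k≗table false true  = refl
      k≗table true  false = refl
      -- Oddness fixes the fourth value as the negation of the one that would make `k` even.
      k≗table true  true  = ¬-not odd

    -- The violation is a sum of four values of F over {0} × {0,1}³, hence the
    -- sum over the three faces of that cube through the origin: one is odd.
    ⊕-violation : ∀ F → Closed₄ F →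
      F false true true false ≢
        F false false true true xor (F false true false true xor F false false false false) →
      Closed₂ _∧_
    ⊕-violation F closed ≢ with Even? (λ u v → F false u v false)
    ... | no odd = odd⇒∧ (λ u v → F false u v false)
          (λ Sk Sl → closed (S-constant _) Sk Sl (S-constant _)) odd
    ... | yes even₁ with Even? (λ u v → F false false u v)
    ...   | no odd = odd⇒∧ (λ u v → F false false u v)
          (λ Sk Sl → closed (S-constant _) (S-constant _) Sk Sl) odd
    ...   | yes even₂ with Even? (λ u v → F false u false v)
    ...     | no odd = odd⇒∧ (λ u v → F false u false v)
          (λ Sk Sl → closed (S-constant _) Sk (S-constant _) Sl) odd
    ...     | yes even₃ = contradiction
      (trans even₁ (trans (faces o (F false true false false)
                            (F false false true false) (F false false false true))
        (sym (cong₂ (λ p q → p xor (q xor o)) even₂ even₃)))) ≢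
      where
      open xor-∧-Solver
      o : Bool
      o = F false false false false
      faces : ∀ o b c d → c xor (b xor o) ≡ (d xor (c xor o)) xor ((d xor (b xor o)) xor o)
      faces = solve 4 (λ o b c d →
        c :+ (b :+ o) := (d :+ (c :+ o)) :+ ((d :+ (b :+ o)) :+ o)) refl

    ∧⇒∨ : Closed₂ _∧_ → Closed₂ _∨_
    ∧⇒∨ closed = Closed₂-resp (λ u v → not (not u ∧ not v)) _∨_
      (λ { false false → refl ; false true → refl ; true _ → refl })
      λ Sk Sl → closed-not (closed (closed-not Sk) (closed-not Sl))

  module _ (closed-∧ : Closed₂ _∧_) (closed-∨ : Closed₂ _∨_) where

    universal : ∀ {n} (ℓ : Fin n → X → Bool) → (∀ i → S (ℓ i)) → (∀ i → S (not ∘ ℓ i)) →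
                (f : BoolFun n) → S (λ z → f (tabulate λ i → ℓ i z))
    universal {zero}  ℓ Sℓ S¬ℓ f = S-constant (f [])
    universal {suc n} ℓ Sℓ S¬ℓ f = S-resp
      (λ z → mux (ℓ zero z) (λ b → f (b ∷ tabulate λ i → ℓ (suc i) z)))
      (closed-∨ (closed-∧ (Sℓ zero)  (universal (ℓ ∘ suc) (Sℓ ∘ suc) (S¬ℓ ∘ suc) (f ∘ (true ∷_))))
                (closed-∧ (S¬ℓ zero) (universal (ℓ ∘ suc) (Sℓ ∘ suc) (S¬ℓ ∘ suc) (f ∘ (false ∷_)))))
      where
      mux : ∀ b (h : Bool → Bool) → b ∧ h true ∨ not b ∧ h false ≡ h b
      mux true  h = Bool.∨-identityʳ (h true)
      mux false h = refl

-- Traces of formulas on a set of points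

xor-isCommutativeMonoid : IsCommutativeMonoid _≡_ _xor_ false
xor-isCommutativeMonoid = CommutativeRing.+-isCommutativeMonoid Bool.xor-∧-commutativeRing

pick : Bool → Bool → Bool → Bool → Bool → Bool → Bool
pick k l m n false false = k
pick k l m n false true  = l
pick k l m n true  false = m
pick k l m n true  true  = n

-- Two variables that are constant on the points supply the truth constants, which `O` may lack.
module Points {O : Basis} {n : ℕ} {X : Set} (point : X → Vec Bool n)
  (⊤-variable : ∃[ i ] ∀ z → lookup (point z) i ≡ true)
  (⊥-variable : ∃[ i ] ∀ z → lookup (point z) i ≡ false) where

  S : (X → Bool) → Set
  S k = ∃[ φ ] ∀ z → eval {O} φ (point z) ≡ k z

  S-constant : ∀ b → S (λ _ → b)
  S-constant true  = let (i , eq) = ⊤-variable in var i , eq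
  S-constant false = let (i , eq) = ⊥-variable in var i , eq

  open Closure S (λ k≗l (φ , eq) → φ , λ z → trans (eq z) (k≗l z)) S-constant public

  module _ {r} (g : BoolFun r) (x y : Vec Bool r) where

    -- Identifies the coordinates of `g` that carry the same pair of bits of `x` and `y`, leaving
    -- one argument for each of 00, 01, 10, 11. The points `x`, `y`, their product and the constant
    -- points are all constant on these blocks, so a violation by `g` is one by this function of
    -- four arguments.
    restriction : Bool → Bool → Bool → Bool → Bool
    restriction a b c d = g (tabulate λ i → pick a b c d (lookup x i) (lookup y i))

    restriction-closed : (r , g) ∈ O → Closed₄ restriction
    restriction-closed g∈O {k} {l} {m} {n} Sk Sl Sm Sn =
      node g∈O (λ i → proj₁ (S-pick (lookup x i) (lookup y i))) , λ z →
        cong g (Vec.tabulate-cong λ i → proj₂ (S-pick (lookup x i) (lookup y i)) z)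
      where
      S-pick : ∀ a b → S (λ z → pick (k z) (l z) (m z) (n z) a b)
      S-pick false false = Sk
      S-pick false true  = Sl
      S-pick true  false = Sm
      S-pick true  true  = Sn

    restriction-at : ∀ (h : Bool → Bool → Bool) {w} → (∀ i → h (lookup x i) (lookup y i) ≡ lookup w i) →
      restriction (h false false) (h false true) (h true false) (h true true) ≡ g w
    restriction-at h {w} eq = cong g (trans
      (Vec.tabulate-cong λ i → trans (pick-table (lookup x i) (lookup y i)) (eq i)) (Vec.tabulate∘lookup w))
      where
      pick-table : ∀ a b → pick (h false false) (h false true) (h true false) (h true true) a b ≡ h a b
      pick-table false false = refl
      pick-table false true  = refl
      pick-table true  false = refl
      pick-table true  true  = refl

    restriction-violation : ∀ (_·_ : Bool → Bool → Bool) ε →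
      g (zipWith _·_ x y) ≢ g x · (g y · g (replicate r ε)) →
      restriction (false · false) (false · true) (true · false) (true · true) ≢
        restriction false false true true · (restriction false true false true · restriction ε ε ε ε)
    restriction-violation _·_ ε ≢ eq = ≢ (trans
      (sym (restriction-at _·_ λ i → sym (Vec.lookup-zipWith _·_ i x y)))
      (trans eq (cong₂ _·_ (restriction-at (λ a _ → a) λ _ → refl)
        (cong₂ _·_ (restriction-at (λ _ b → b) λ _ → refl)
          (restriction-at (λ _ _ → ε) λ i → sym (Vec.lookup-replicate i ε))))))

  -- Given negation, a violation of affinity yields ∧, and ∨ follows by De Morgan.
  not⇒closed-∧∨ : ¬ O ≼ ⊕⊤⊥ → Closed₁ not → Closed₂ _∧_ × Closed₂ _∨_
  not⇒closed-∧∨ ¬⊕ closed-not = closed-∧ , ∧⇒∨ closed-not closed-∧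
    where
    closed-∧ : Closed₂ _∧_
    closed-∧ =
      let (_ , g , g∈O , x , y , ≢) = Linear.¬≼⇒¬affine xor-isCommutativeMonoid O ¬⊕ in
      ⊕-violation closed-not (restriction g x y) (restriction-closed g x y g∈O)
        (restriction-violation g x y _xor_ false ≢)

  closed-∧∨ : ¬ O ≼ ∧⊤⊥ → ¬ O ≼ ∨⊤⊥ → ¬ O ≼ ⊕⊤⊥ → Closed₂ _∧_ × Closed₂ _∨_
  closed-∧∨ ¬∧ ¬∨ ¬⊕
    with Linear.¬≼⇒¬affine Bool.∧-isCommutativeMonoid O ¬∧
       | Linear.¬≼⇒¬affine Bool.∨-isCommutativeMonoid O ¬∨
  ... | _ , g , g∈O , x , y , ≢ | _ , g′ , g′∈O , x′ , y′ , ≢′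
    with ∧-violation (restriction g x y) (restriction-closed g x y g∈O)
           (restriction-violation g x y _∧_ true ≢)
       | ∨-violation (restriction g′ x′ y′) (restriction-closed g′ x′ y′ g′∈O)
           (restriction-violation g′ x′ y′ _∨_ false ≢′)
  ... | inj₁ closed-not | _               = not⇒closed-∧∨ ¬⊕ closed-not
  ... | inj₂ _          | inj₁ closed-not = not⇒closed-∧∨ ¬⊕ closed-not
  ... | inj₂ closed-∨   | inj₂ closed-∧   = closed-∧ , closed-∨

-- The shattered cube

point : ∀ m r → Vec Bool m → Vec Bool (2 + (m + (m + r)))
point m r z = true ∷ false ∷ z ++ (Vec.map not z ++ replicate r false)

Realises-cube : ∀ {O} → ¬ O ≼ ∧⊤⊥ → ¬ O ≼ ∨⊤⊥ → ¬ O ≼ ⊕⊤⊥ → ∀ m r →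
                Realises [ O ] (tabulate (point m r ∘ vector m))
Realises-cube {O} ¬∧ ¬∨ ¬⊕ m r μ =
  let (φ , eq) = universal (proj₁ closed) (proj₂ closed) (λ i z → lookup z i) S-literal S-negation
                   -- The function to be realised sends the vertex z to the bit that `μ` prescribes
                   -- at `point m r z`.
                   (lookup μ ∘ index)
  in eval φ , (φ , λ _ → refl) , (begin
    Vec.map (eval φ) (tabulate (point m r ∘ vector m))
      ≡⟨ Vec.tabulate-∘ (eval φ) (point m r ∘ vector m) ⟨
    tabulate (eval φ ∘ point m r ∘ vector m)
      ≡⟨ Vec.tabulate-cong (λ k → trans (eq (vector m k)) (cong (lookup μ)
           (trans (cong index (Vec.tabulate∘lookup (vector m k))) (index-vector m k)))) ⟩
    tabulate (lookup μ)
      ≡⟨ Vec.tabulate∘lookup μ ⟩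
    μ ∎)
  where
  open ≡-Reasoning
  open Points {O} (point m r) (zero , λ _ → refl) (suc zero , λ _ → refl)
  closed : Closed₂ _∧_ × Closed₂ _∨_
  closed = closed-∧∨ ¬∧ ¬∨ ¬⊕
  S-literal : ∀ i → S (λ z → lookup z i)
  S-literal i = var (suc (suc (i ↑ˡ (m + r)))) , λ z → Vec.lookup-++ˡ z _ i
  S-negation : ∀ i → S (λ z → not (lookup z i))
  S-negation i = var (suc (suc (m ↑ʳ (i ↑ˡ r)))) , λ z →
    trans (Vec.lookup-++ʳ z _ (i ↑ˡ r))
      (trans (Vec.lookup-++ˡ (Vec.map not z) _ i) (Vec.lookup-map i not z))

-- The cube of dimension m = ⌊(n − 2) / 2⌋ fits, and n ≤ 2m + 3 ≤ 5m once m ≥ 1.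
split : ∀ n → 4 ≤ n → ∃₂ λ m r → n ≡ 2 + (m + (m + r)) × n ≤ m * 5
split (suc (suc n)) (s≤s (s≤s 2≤n)) = m , r , cong (2 +_) n≡ , (begin
  2 + n             ≡⟨ cong (2 +_) n≡ ⟩
  2 + (m + (m + r)) ≤⟨ ℕ.+-monoʳ-≤ 2 (ℕ.+-monoʳ-≤ m (ℕ.+-monoʳ-≤ m (ℕ.≤-pred (m%n<n n 2)))) ⟩
  2 + (m + (m + 1)) ≡⟨ regroup m ⟩
  1 * 3 + m * 2     ≤⟨ ℕ.+-monoˡ-≤ (m * 2) (ℕ.*-monoˡ-≤ 3 (m≥n⇒m/n>0 2≤n)) ⟩
  m * 3 + m * 2     ≡⟨ ℕ.*-distribˡ-+ m 3 2 ⟨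
  m * 5             ∎)
  where
  open ℕ.≤-Reasoning
  m r : ℕ
  m = n / 2
  r = n % 2
  halves : ∀ q r → r + q * 2 ≡ q + (q + r)
  halves = solve-∀
  regroup : ∀ m → 2 + (m + (m + 1)) ≡ 1 * 3 + m * 2
  regroup = solve-∀
  n≡ : n ≡ m + (m + r)
  n≡ = trans (m≡m%n+[m/n]*n n 2) (halves m r)

-- The linear and the exponential case

proposition1p4 : (O : Basis) →
    ((O ≼ ∧⊤⊥ ⊎ O ≼ ∨⊤⊥ ⊎ O ≼ ⊕⊤⊥) →
    ∀ n → 1 ≤ n → ∃[ d ] IsVCDimPL O n d × d ≤ n + 1)
    × (¬ (O ≼ ∧⊤⊥ ⊎ O ≼ ∨⊤⊥ ⊎ O ≼ ⊕⊤⊥) →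
    Is2^Ω⟨n⟩ (IsVCDimPL O))
proposition1p4 O = small , large
  where
  small : (O ≼ ∧⊤⊥ ⊎ O ≼ ∨⊤⊥ ⊎ O ≼ ⊕⊤⊥) → ∀ n → 1 ≤ n → ∃[ d ] IsVCDimPL O n d × d ≤ n + 1
  -- Since n is positive, there is a variable and the class is nonempty.
  small O≼ n@(suc _) _ = let (d , dim) = IsVCDimPL-exists O n (var zero) in d , dim , bound O≼ dim
    where
    bound : ∀ {d} → (O ≼ ∧⊤⊥ ⊎ O ≼ ∨⊤⊥ ⊎ O ≼ ⊕⊤⊥) → IsVCDimPL O n d → d ≤ n + 1
    bound (inj₁ O≼∧)        = Linear.≼⇒IsVCDim-≤ Bool.∧-isCommutativeMonoid O≼∧
    bound (inj₂ (inj₁ O≼∨)) = Linear.≼⇒IsVCDim-≤ Bool.∨-isCommutativeMonoid O≼∨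
    bound (inj₂ (inj₂ O≼⊕)) = Linear.≼⇒IsVCDim-≤ xor-isCommutativeMonoid O≼⊕

  large : ¬ (O ≼ ∧⊤⊥ ⊎ O ≼ ∨⊤⊥ ⊎ O ≼ ⊕⊤⊥) → Is2^Ω⟨n⟩ (IsVCDimPL O)
  -- The rate is c = 1/5: for n at least 4, `split` gives n ≤ 5m with a shattered set of size
  -- `2 ^ m`, hence `2 ^ n` is at most `d ^ 5`.
  large ¬small = 1 , 5 , 4 , s≤s z≤n , s≤s z≤n , bound
    where
    bound : ∀ n → 4 ≤ n → ∃[ d ] IsVCDimPL O n d × 2 ^ (1 * n) ≤ d ^ 5
    bound n 4≤n with split n 4≤n
    ... | m , r , refl , n≤m*5 = let (d , dim) = IsVCDimPL-exists O n (var zero) in d , dim , (begin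
      2 ^ (1 * n)  ≡⟨ cong (2 ^_) (ℕ.*-identityˡ n) ⟩
      2 ^ n        ≤⟨ ℕ.^-monoʳ-≤ 2 n≤m*5 ⟩
      2 ^ (m * 5)  ≡⟨ ℕ.^-*-assoc 2 m 5 ⟨
      (2 ^ m) ^ 5  ≤⟨ ℕ.^-monoˡ-≤ 5 (IsVCDim-≥ (Realises-cube (¬small ∘ inj₁) (¬small ∘ inj₂ ∘ inj₁)
                        (¬small ∘ inj₂ ∘ inj₂) m r) dim) ⟩
      d ^ 5        ∎)
      where open ℕ.≤-Reasoning
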